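{- Let $f,g,h:\{0,1\}^n\to\{0,1\}$ be such that $f=g\vee h$. Let $g_\ell,g_u:\{0,1\}^n\to\{0,1\}$ be $\varepsilon$-sandwiching approximators for $g$. Then $g_\ell\vee h$ and $g_u\vee h$ are $\varepsilon$-sandwiching approximators for $f$.
   Context: Functions $f_\ell,f_u:\{0,1\}^n\to\{0,1\}$ are $\varepsilon$-sandwiching approximators for $f:\{0,1\}^n\to\{0,1\}$ if $f_\ell(x)\le f(x)\le f_u(x)$ for every $x\in\{0,1\}^n$, and $\Pr_x[f_\ell(x)\ne f(x)]\le\varepsilon$ and $\Pr_x[f_u(x)\ne f(x)]\le\varepsilon$ for $x$ uniform in $\{0,1\}^n$. Here $\vee$ is pointwise OR. -}

module Defs where

open import Data.Bool using (Bool; true; false; _∨_; _≤_; _≟_)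
open import Data.Integer using (+_)
open import Data.List using (List; []; _∷_; _++_; map; filter; length)
open import Data.List.Membership.Propositional using (_∈_)
open import Data.List.Membership.Propositional.Properties using (∈-map⁺; ∈-++⁺ˡ; ∈-++⁺ʳ)
open import Data.List.Properties using (length-++; length-map)
open import Data.List.Relation.Unary.Any using (here)
open import Data.Nat using (ℕ; zero; suc; _^_)
import Data.Nat as ℕ
open import Data.Nat.Properties using (m^n≢0; +-identityʳ)
open import Data.Product using (∃-syntax; _×_)
open import Data.Rational using (ℚ; _<_; _/_)
open import Data.Sum using (_⊎_)
open import Data.Vec using (Vec; []; _∷_)
open import Function using (_⇔_)
open import Level using (Level)
open import Relation.Binary.PropositionalEquality using (_≡_; _≢_; refl; sym; trans; cong₂)
open import Relation.Nullary using (¬_; ¬?)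
open import Relation.Unary using (Pred; Decidable)

-- Two-sided Dedekind cuts: L (U) holds the rationals strictly below (above).
record ℝ : Set₁ where
  field
    L U         : ℚ → Set
    L-inhabited : ∃[ q ] L q
    U-inhabited : ∃[ q ] U q
    L-rounded   : ∀ q → L q ⇔ (∃[ r ] (q < r × L r))
    U-rounded   : ∀ q → U q ⇔ (∃[ r ] (r < q × U r))
    disjoint    : ∀ q → ¬ (L q × U q)
    located     : ∀ q r → q < r → L q ⊎ U r

infix 4 _≤ᴿ_

-- The order between a rational and a real; L being the rationals strictly
-- below x, q ≤ x says that every rational strictly below q lies in L.
_≤ᴿ_ : ℚ → ℝ → Set
q ≤ᴿ x = ∀ r → r < q → ℝ.L x r

BoolFun : ℕ → Set
BoolFun n = Vec Bool n → Bool

infixr 5 _∨̇_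

_∨̇_ : ∀ {n} → BoolFun n → BoolFun n → BoolFun n
(g ∨̇ h) x = g x ∨ h x

cube : (n : ℕ) → List (Vec Bool n)
cube zero    = [] ∷ []
cube (suc n) = map (false ∷_) (cube n) ++ map (true ∷_) (cube n)

-- The next two facts together say that cube n lists every point exactly once.
∈-cube : ∀ {n} (x : Vec Bool n) → x ∈ cube n
∈-cube []          = here refl
∈-cube (false ∷ x) = ∈-++⁺ˡ (∈-map⁺ (false ∷_) (∈-cube x))
∈-cube (true ∷ x)  = ∈-++⁺ʳ (map (false ∷_) (cube _)) (∈-map⁺ (true ∷_) (∈-cube x))

length-cube : ∀ n → length (cube n) ≡ 2 ^ n
length-cube zero    = refl
length-cube (suc n) =
  trans (length-++ (map (false ∷_) (cube n)))
        (cong₂ ℕ._+_ (trans (length-map (false ∷_) (cube n)) (length-cube n))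
                     (trans (trans (length-map (true ∷_) (cube n)) (length-cube n))
                            (sym (+-identityʳ (2 ^ n)))))

Pr : ∀ {n} {ℓ : Level} {P : Pred (Vec Bool n) ℓ} → Decidable P → ℚ
Pr {n} P? = _/_ (+ length (filter P? (cube n))) (2 ^ n) {{m^n≢0 2 n}}

Pr[_≠_] : ∀ {n} → BoolFun n → BoolFun n → ℚ
Pr[ f ≠ g ] = Pr {P = λ x → f x ≢ g x} (λ x → ¬? (f x ≟ g x))

record Sandwiching {n : ℕ} (ε : ℝ) (fₗ fᵤ f : BoolFun n) : Set where
  field
    lower       : ∀ x → fₗ x ≤ f x
    upper       : ∀ x → f x ≤ fᵤ x
    lower-error : Pr[ fₗ ≠ f ] ≤ᴿ ε
    upper-error : Pr[ fᵤ ≠ f ] ≤ᴿ ε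

{-# OPTIONS --safe #-}
-- Pointwise OR with h is monotone, so it preserves the two inequalities, and it
-- can only shrink the disagreement set: if g' ∨ h and g ∨ h differ at a point,
-- then so do g' and g.
module Submission where

open import Data.Bool using (_∨_; b≤b; f≤t)
import Data.Bool as Bool
import Data.Bool.Properties as Bool
open import Data.Integer using (ℤ; +_; +≤+)
import Data.Integer as ℤ
import Data.Integer.Properties as ℤ
open import Data.List.Relation.Binary.Sublist.Propositional using (⊆-refl)
open import Data.List.Relation.Binary.Sublist.Propositional.Properties using (filter⁺; length-mono-≤)
open import Data.Nat using (ℕ; suc; _^_; NonZero)
open import Data.Nat.Properties using (m^n≢0)
open import Data.Rational using (_/_; _≤_)
open import Data.Rational.Properties using (toℚᵘ-cancel-≤; toℚᵘ-fromℚᵘ; <-≤-trans)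
open import Data.Rational.Unnormalised using (mkℚᵘ; *≤*)
import Data.Rational.Unnormalised.Properties as ℚᵘ
open import Data.Vec using (Vec)
open import Level using (Level)
open import Relation.Binary.PropositionalEquality using (_≗_; refl; sym; trans; cong; subst)
open import Relation.Nullary using (¬?)
open import Relation.Unary using (Pred; Decidable; _⊆_)
open import Defs

private
  variable
    n   : ℕ
    p q : Level

-- Replace `f` by `g ∨̇ h` pointwise. The order bounds are then monotonicity of OR. For the errors,
-- `g' ∨̇ h` can differ from `g ∨̇ h` only where `g'` differs from `g`, so `Pr≠-∨̇` bounds each new
-- error by the old one, which is at most `ε`.

∨-monoˡ-≤ : ∀ c {a b} → a Bool.≤ b → a ∨ c Bool.≤ b ∨ c
∨-monoˡ-≤ c b≤b = b≤b
∨-monoˡ-≤ c f≤t = Bool.≤-maximum c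

-- `i / d` is stored in lowest terms, which hides the common denominator; the unnormalised fractions
-- keep it, so cross-multiplying compares `i` with `j`.
/-monoˡ-≤ : ∀ d .{{_ : NonZero d}} {i j : ℤ} → i ℤ.≤ j → i / d ≤ j / d
/-monoˡ-≤ (suc d) {i} {j} i≤j = toℚᵘ-cancel-≤ (begin
  _         ≃⟨ toℚᵘ-fromℚᵘ (mkℚᵘ i d) ⟩
  mkℚᵘ i d  ≤⟨ *≤* (ℤ.*-monoʳ-≤-nonNeg (+ suc d) i≤j) ⟩
  mkℚᵘ j d  ≃⟨ toℚᵘ-fromℚᵘ (mkℚᵘ j d) ⟨
  _         ∎)
  where open ℚᵘ.≤-Reasoning

Pr-mono-⊆ : {P : Pred (Vec _ n) p} {Q : Pred (Vec _ n) q}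
            (P? : Decidable P) (Q? : Decidable Q) → P ⊆ Q → Pr P? ≤ Pr Q?
Pr-mono-⊆ {n = n} P? Q? P⊆Q = /-monoˡ-≤ (2 ^ n) {{m^n≢0 2 n}}
  -- Filtering one list by a stronger predicate leaves a sublist, hence a shorter or equal count.
  (+≤+ (length-mono-≤ (filter⁺ P? Q? (λ { refl → P⊆Q }) (⊆-refl {x = cube n}))))

≤-≤ᴿ-trans : ∀ {a b} (x : ℝ) → a ≤ b → b ≤ᴿ x → a ≤ᴿ x
≤-≤ᴿ-trans x a≤b b≤x r r<a = b≤x r (<-≤-trans r<a a≤b)

Pr≠-∨̇ : {f g h : BoolFun n} → f ≗ (g ∨̇ h) → (g' : BoolFun n) →
        Pr[ g' ∨̇ h ≠ f ] ≤ Pr[ g' ≠ g ]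
Pr≠-∨̇ {f = f} {g} {h} f≗g∨h g' = Pr-mono-⊆
  (λ x → ¬? ((g' ∨̇ h) x Bool.≟ f x)) (λ x → ¬? (g' x Bool.≟ g x))
  -- By contraposition: agreement of `g'` and `g` at `x` survives OR with `h x`.
  (λ {x} g'∨h≢f g'≡g → g'∨h≢f (trans (cong (_∨ h x) g'≡g) (sym (f≗g∨h x))))

lemma2p6 : (n : ℕ) (ε : ℝ) (f g h : BoolFun n) → f ≗ (g ∨̇ h) →
    (gₗ gᵤ : BoolFun n) → Sandwiching ε gₗ gᵤ g →
    Sandwiching ε (gₗ ∨̇ h) (gᵤ ∨̇ h) f
lemma2p6 n ε f g h f≗g∨h gₗ gᵤ s = record
  { lower       = λ x → subst (_ Bool.≤_) (sym (f≗g∨h x)) (∨-monoˡ-≤ (h x) (lower x))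
  ; upper       = λ x → subst (Bool._≤ _) (sym (f≗g∨h x)) (∨-monoˡ-≤ (h x) (upper x))
  ; lower-error = ≤-≤ᴿ-trans ε (Pr≠-∨̇ f≗g∨h gₗ) lower-error
  ; upper-error = ≤-≤ᴿ-trans ε (Pr≠-∨̇ f≗g∨h gᵤ) upper-error
  }
  where open Sandwiching s
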